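{- There is a constant $C>0$ such that for every integer $n\ge 1$ (for $n\ge 2$ if one wants $\log^2 n>0$; for $n=0,1$ the statement is trivial), there exists a graph $H_n$ with at most $3^{n+C\log^2 n}$ vertices that is isometric-universal for the class $\mathcal{G}_n$ of all $n$-vertex graphs. That is, the class $\mathcal{G}_n$ has an isometric-universal graph on at most $3^{n+O(\log^2 n)}$ vertices.
   Context: All graphs are finite and simple. $d_G(u,v)$ denotes the distance between $u$ and $v$ in $G$ (possibly $\infty$). A subgraph $G$ of a graph $H$ is isometric if $d_G(u,v)=d_H(u,v)$ for all $u,v\in V(G)$. A graph $H$ is isometric-universal for a class $\mathcal{C}$ of graphs if $H$ contains an isometric subgraph isomorphic to $G$ for every $G\in\mathcal{C}$. $\log$ denotes the binary logarithm. -}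

module Defs where

open import Data.Nat using (ℕ; zero; suc; _≤_)
open import Data.Fin using (Fin)
open import Data.Bool using (Bool; T)
open import Data.Maybe using (Maybe; just; nothing)
open import Data.Product using (_×_; Σ)
open import Data.Empty using (⊥)
open import Relation.Nullary using (¬_)
open import Relation.Binary.PropositionalEquality using (_≡_)
open import Function.Bundles using (_⇔_)
open import Function.Definitions using (Injective)

record Graph (n : ℕ) : Set where
  field
    adj    : Fin n → Fin n → Bool
    sym    : ∀ u v → adj u v ≡ adj v u
    irrefl : ∀ u → adj u u ≡ Data.Bool.false

open Graph public

Adj : ∀ {n} → Graph n → Fin n → Fin n → Set
Adj G u v = T (adj G u v)

data Walk {n : ℕ} (G : Graph n) : ℕ → Fin n → Fin n → Set where
  nil  : ∀ {u} → Walk G zero u u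
  cons : ∀ {k u w v} → Adj G u w → Walk G k w v → Walk G (suc k) u v

IsDist : ∀ {n} → Graph n → Fin n → Fin n → Maybe ℕ → Set
IsDist G u v (just k) = Walk G k u v × (∀ j → Walk G j u v → k ≤ j)
IsDist G u v nothing  = ∀ j → ¬ Walk G j u v

-- H contains an isometric subgraph isomorphic to G: an injective map f
-- sending edges of G to edges of H (so f(G) is a subgraph of H isomorphic
-- to G) with d_G(u,v) = d_H(f u, f v) for all u, v.
IsometricEmbedding : ∀ {n m} → Graph n → Graph m → (Fin n → Fin m) → Set
IsometricEmbedding G H f =
  Injective _≡_ _≡_ f
  × (∀ u v → Adj G u v → Adj H (f u) (f v))
  × (∀ u v (d : Maybe ℕ) → IsDist G u v d ⇔ IsDist H (f u) (f v) d)

HasIsometricCopy : ∀ {n m} → Graph m → Graph n → Set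
HasIsometricCopy H G = Σ _ (IsometricEmbedding G H)

IsometricUniversal : ∀ {m} → (n : ℕ) → Graph m → Set
IsometricUniversal n H = (G : Graph n) → HasIsometricCopy H G

{-# OPTIONS --safe #-}
-- In a depth-first search forest of G every edge joins an ancestor and a descendant. The forest is
-- placed in a universal rooted forest with 2 ^ O(log² n) vertices, and a vertex u is labelled by its position
-- together with the distances from u to its ancestors; these change by at most one along a
-- tree edge, so there are at most 3 ^ n choices per position. Two labels are adjacent when their
-- positions are comparable and the distances to every common ancestor differ by at most one.
-- As consecutive positions are comparable, the topmost position r on a walk from u to v is an ancestor of
-- all the others; the encoded distance to r is 0 there, so the walk has length at least d(u,r) + d(r,v).
module Submission where

open import Defs
open import Data.Nat using (ℕ; zero; suc; pred; _≤_; _<_; _+_; _*_; _^_; _≤ᵇ_; _≤?_; z≤n; s≤s; s≤s⁻¹; ⌊_/2⌋; ⌈_/2⌉)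
open import Data.Nat.Logarithm using (⌈log₂_⌉)
open import Data.Nat.Logarithm.Core using (⌈log2⌉)
open import Data.Nat.Induction using (acc; <-wellFounded)
open import Data.Nat.Properties
open import Data.Nat.Tactic.RingSolver using (solve-∀)
open import Data.Bool using (Bool; false; T; _∧_)
open import Data.Bool.Properties using (∧-comm; T-∧; T?)
open import Data.Empty using (⊥; ⊥-elim)
open import Data.Fin using (Fin)
open import Data.Fin.Properties using (any?) renaming (_≟_ to _≟ᶠ_)
open import Data.List using (List; []; _∷_; _++_; map; length; filter; lookup; allFin)
open import Data.List.Properties using (length-++; length-map; length-tabulate; filter-notAll)
open import Data.List.Membership.Propositional using (_∈_; _∉_)
open import Data.List.Membership.Propositional.Properties
  using (∈-map⁺; ∈-++⁺ˡ; ∈-++⁺ʳ; ∈-filter⁺; ∈-filter⁻; ∈-allFin)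
open import Data.List.Relation.Unary.Any as Any using (index)
open import Data.List.Relation.Unary.Any.Properties using (lookup-index)
open import Data.Maybe using (just; nothing)
open import Data.Product using (Σ; ∃; _×_; _,_; proj₁; proj₂)
open import Data.Sum using (_⊎_; inj₁; inj₂)
open import Function using (_∘_; id)
open import Function.Bundles using (Equivalence; mk⇔)
open import Relation.Nullary using (¬_; Dec; yes; no; ¬?)
open import Relation.Nullary.Decidable using (_×-dec_; map′)
open import Relation.Binary.PropositionalEquality
  using (_≡_; _≢_; refl; cong; cong₂; subst; subst₂) renaming (sym to ≡-sym; trans to ≡-trans)

-- Distances in a graph

module _ {N : ℕ} (G : Graph N) where

  Adj-sym : ∀ {u v} → Adj G u v → Adj G v u
  Adj-sym {u} {v} = subst T (Graph.sym G u v)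

  Adj-irrefl : ∀ {u} → ¬ Adj G u u
  Adj-irrefl {u} = subst T (irrefl G u)

  _++ʷ_ : ∀ {i j u v w} → Walk G i u v → Walk G j v w → Walk G (i + j) u w
  nil      ++ʷ q = q
  cons e p ++ʷ q = cons e (p ++ʷ q)

  snoc : ∀ {k u v w} → Walk G k u v → Adj G v w → Walk G (suc k) u w
  snoc nil        e = cons e nil
  snoc (cons f p) e = cons f (snoc p e)

  reverseʷ : ∀ {k u v} → Walk G k u v → Walk G k v u
  reverseʷ nil        = nil
  reverseʷ (cons e p) = snoc (reverseʷ p) (Adj-sym e)

  walk? : ∀ k u v → Dec (Walk G k u v)
  walk? zero u v = map′ (λ { refl → nil }) (λ { nil → refl }) (u ≟ᶠ v)
  walk? (suc k) u v =
    map′ (λ { (_ , e , p) → cons e p }) (λ { (cons e p) → _ , e , p })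
         (any? λ w → T? (adj G u w) ×-dec walk? k w v)

data Step : Set where
  down stay up : Step

move : Step → ℕ → ℕ
move down = pred
move stay = id
move up   = suc

module _ {N : ℕ} (G : Graph N) where

  -- The edge extends walks to `v` and to `w` into each other, so the new distance is between
  -- `pred d` and `suc d`. Deciding whether walks of length `pred d` and `d` exist selects the step.
  dist-step : ∀ {u v w d} → IsDist G u v (just d) → Adj G w v →
              ∃ λ s → IsDist G u w (just (move s d))
  dist-step {u} {v} {w} {d} (p , least) e with walk? G (pred d) u w
  ... | yes q = down , q , λ j r → pred-mono-≤ (least (suc j) (snoc G r e))
  ... | no ¬q = lemma (walk? G d u w)
    where
    d≤ : ∀ j → Walk G j u w → d ≤ j
    d≤ j r = ≤-trans (m≤n+m∸n d 1) (≤∧≢⇒< (pred-mono-≤ (least (suc j) (snoc G r e))) λ { refl → ¬q r })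

    lemma : Dec (Walk G d u w) → ∃ λ s → IsDist G u w (just (move s d))
    lemma (yes r) = stay , r , d≤
    lemma (no ¬r) = up , snoc G p (Adj-sym G e) , λ j r → ≤∧≢⇒< (d≤ j r) λ { refl → ¬r r }

  dist-Lipschitz : ∀ {u v w a b} → Adj G u v → IsDist G u w (just a) → IsDist G v w (just b) → a ≤ suc b
  dist-Lipschitz e (_ , least) (q , _) = least _ (cons e q)

-- The universal graph

data Part : Set where
  before amid after : Part

_≟ᵖ_ : (s t : Part) → Dec (s ≡ t)
before ≟ᵖ before = yes refl
before ≟ᵖ amid   = no λ ()
before ≟ᵖ after  = no λ ()
amid   ≟ᵖ before = no λ ()
amid   ≟ᵖ amid   = yes refl
amid   ≟ᵖ after  = no λ ()
after  ≟ᵖ before = no λ ()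
after  ≟ᵖ amid   = no λ ()
after  ≟ᵖ after  = yes refl

-- A label is a vertex of the universal rooted forest U k n, in which every forest of depth at most n
-- with at most 2 ^ k vertices embeds, with a step on each edge of its root path: U (suc k) (suc n)
-- consists of two copies of U k (suc n) and of a tree whose root has U (suc k) n below it.
data Label : ℕ → ℕ → Set where
  here  : ∀ {k n} → Label k (suc n)
  left  : ∀ {k n} → Label k (suc n) → Label (suc k) (suc n)
  right : ∀ {k n} → Label k (suc n) → Label (suc k) (suc n)
  below : ∀ {k n} → Step → Label (suc k) n → Label (suc k) (suc n)

-- The encoded distance to the root of the tree that contains the position.
top : ∀ {k n} → Label k n → ℕ
top here        = 0
top (left x)    = top x
top (right x)   = top x
top (below s x) = move s (top x)

close : ℕ → ℕ → Bool
close a b = (a ≤ᵇ suc b) ∧ (b ≤ᵇ suc a)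

-- The recursion visits the common ancestors from the top down; an ancestor has distance 0 to
-- itself. The last clause covers incomparable positions, and `here` with itself.
adjᴸ : ∀ {k n} → Label k n → Label k n → Bool
adjᴸ (left x)    (left y)    = adjᴸ x y
adjᴸ (right x)   (right y)   = adjᴸ x y
adjᴸ here        (below t y) = close 0 (top (below t y))
adjᴸ (below s x) here        = close (top (below s x)) 0
adjᴸ (below s x) (below t y) = close (top (below s x)) (top (below t y)) ∧ adjᴸ x y
adjᴸ _           _           = false

Adjᴸ : ∀ {k n} → Label k n → Label k n → Set
Adjᴸ x y = T (adjᴸ x y)

close⁺ : ∀ {a b} → a ≤ suc b → b ≤ suc a → T (close a b)
close⁺ p q = Equivalence.from T-∧ (≤⇒≤ᵇ p , ≤⇒≤ᵇ q)

close⁻ : ∀ a b → T (close a b) → a ≤ suc b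
close⁻ a b c = ≤ᵇ⇒≤ a (suc b) (proj₁ (Equivalence.to T-∧ c))

close-comm : ∀ a b → close a b ≡ close b a
close-comm a b = ∧-comm (a ≤ᵇ suc b) (b ≤ᵇ suc a)

adjᴸ-sym : ∀ {k n} (x y : Label k n) → adjᴸ x y ≡ adjᴸ y x
adjᴸ-sym (left x)    (left y)    = adjᴸ-sym x y
adjᴸ-sym (right x)   (right y)   = adjᴸ-sym x y
adjᴸ-sym here        (below t y) = close-comm 0 (top (below t y))
adjᴸ-sym (below s x) here        = close-comm (top (below s x)) 0
adjᴸ-sym (below s x) (below t y) = cong₂ _∧_ (close-comm (top (below s x)) (top (below t y))) (adjᴸ-sym x y)
adjᴸ-sym here        here        = refl
adjᴸ-sym here        (left y)    = refl
adjᴸ-sym here        (right y)   = refl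
adjᴸ-sym (left x)    here        = refl
adjᴸ-sym (left x)    (right y)   = refl
adjᴸ-sym (left x)    (below t y) = refl
adjᴸ-sym (right x)   here        = refl
adjᴸ-sym (right x)   (left y)    = refl
adjᴸ-sym (right x)   (below t y) = refl
adjᴸ-sym (below s x) (left y)    = refl
adjᴸ-sym (below s x) (right y)   = refl

adjᴸ-irrefl : ∀ {k n} (x : Label k n) → adjᴸ x x ≡ false
adjᴸ-irrefl here        = refl
adjᴸ-irrefl (left x)    = adjᴸ-irrefl x
adjᴸ-irrefl (right x)   = adjᴸ-irrefl x
adjᴸ-irrefl (below s x) rewrite adjᴸ-irrefl x = ∧-comm (close (move s (top x)) (move s (top x))) false

top-Lipschitz : ∀ {k n} (x y : Label k n) → Adjᴸ x y → top x ≤ suc (top y)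
top-Lipschitz (left x)    (left y)    e = top-Lipschitz x y e
top-Lipschitz (right x)   (right y)   e = top-Lipschitz x y e
top-Lipschitz here        (below t y) e = z≤n
top-Lipschitz (below s x) here        e = close⁻ _ _ e
top-Lipschitz (below s x) (below t y) e = close⁻ _ _ (proj₁ (Equivalence.to T-∧ e))

-- Paths of labels

data Path {k n : ℕ} : ℕ → Label k n → Label k n → Set where
  nil  : ∀ {x} → Path zero x x
  cons : ∀ {j x y z} → Adjᴸ x y → Path j y z → Path (suc j) x z

part : ∀ {k n} → Label k n → Part
part here        = amid
part (left x)    = before
part (right x)   = after
part (below s x) = amid

-- Each clause of `adjᴸ` that can hold stays within one part, so the parts are unions of components:
-- a path between two `left` labels never leaves `left`, and likewise for `right`.
adjᴸ-part : ∀ {k n} (x y : Label k n) → Adjᴸ x y → part x ≡ part y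
adjᴸ-part (left x)    (left y)    e = refl
adjᴸ-part (right x)   (right y)   e = refl
adjᴸ-part here        (below t y) e = refl
adjᴸ-part (below s x) here        e = refl
adjᴸ-part (below s x) (below t y) e = refl

path-part : ∀ {k n j} {x y : Label k n} → Path j x y → part x ≡ part y
path-part nil                = refl
path-part (cons {x = x} e p) = ≡-trans (adjᴸ-part x _ e) (path-part p)

path-left : ∀ {k n j} {x y : Label k (suc n)} → Path j (left x) (left y) → Path j x y
path-left nil                     = nil
path-left (cons {y = left _} e p) = cons e (path-left p)

path-right : ∀ {k n j} {x y : Label k (suc n)} → Path j (right x) (right y) → Path j x y
path-right nil                      = nil
path-right (cons {y = right _} e p) = cons e (path-right p)

path-top : ∀ {k n j} {x y : Label k n} → Path j x y → top y ≤ j + top x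
path-top nil = ≤-refl
path-top (cons {j} {x} {y} {z} e p) = begin
  top z           ≤⟨ path-top p ⟩
  j + top y       ≤⟨ +-monoʳ-≤ j (top-Lipschitz y x (subst T (adjᴸ-sym x y) e)) ⟩
  j + suc (top x) ≡⟨ +-suc j (top x) ⟩
  suc j + top x   ∎
  where open ≤-Reasoning

path-from-here : ∀ {k n j} {y : Label k (suc n)} → Path j here y → top y ≤ j
path-from-here {j = j} p = subst (_ ≤_) (+-identityʳ j) (path-top p)

-- If the path avoids the root `here`, then `below` can be stripped from all its labels. Otherwise
-- it meets `here`, where `top` is 0; each edge changes `top` by at most one, so the stretches
-- before and after have at least the lengths given by `top` at the two ends.
path-below : ∀ {k n j s t} {x y : Label (suc k) n} → Path j (below s x) (below t y) →
             Path j x y ⊎ top (below s x) + top (below t y) ≤ j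
path-below nil = inj₁ nil
path-below {s = s} {x = x} (cons {y = here} e p) =
  inj₂ (+-mono-≤ (close⁻ (top (below s x)) 0 e) (path-from-here p))
path-below {s = s} {x = x} (cons {y = below r z} e p) with Equivalence.to T-∧ e | path-below p
... | c , a | inj₁ q = inj₁ (cons a q)
... | c , a | inj₂ q = inj₂ (≤-trans (+-monoˡ-≤ _ (close⁻ (top (below s x)) _ c)) (s≤s q))

path-to-here : ∀ {k n j} {x : Label k (suc n)} → Path j x here → top x ≤ j
path-to-here nil = z≤n
path-to-here (cons {x = x} {y} e p) = ≤-trans (top-Lipschitz x y e) (s≤s (path-to-here p))

-- Isometric labellings

module _ {N : ℕ} (G : Graph N) where

  -- `P` holds the labelled vertices and `R` the roots of their trees. Distances in `root` are those
  -- of all of `G`, so adding ancestors later does not alter them. By `walk`, paths of labels offer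
  -- no shortcut, even through labels that belong to no vertex.
  record Labelling (k n : ℕ) (P R : Fin N → Set) : Set where
    field
      label : ∀ {u} → P u → Label k n
      root  : ∀ {u} (p : P u) → ∃ λ r → R r × IsDist G u r (just (top (label p)))
      edge  : ∀ {u v} (p : P u) (q : P v) → Adj G u v → Adjᴸ (label p) (label q)
      walk  : ∀ {u v j} (p : P u) (q : P v) → Path j (label p) (label q) → ∃ λ i → i ≤ j × Walk G i u v

  open Labelling

  restrict : ∀ {k n P P′ R R′} → (∀ {u} → P′ u → P u) → (∀ {r} → R r → R′ r) →
             Labelling k n P R → Labelling k n P′ R′
  restrict f g L .label p = L .label (f p)
  restrict f g L .root p with L .root (f p)
  ... | r , r∈R , d = r , g r∈R , d
  restrict f g L .edge p q = L .edge (f p) (f q)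
  restrict f g L .walk p q = L .walk (f p) (f q)

  empty : ∀ {k n P R} → (∀ {u} → ¬ P u) → Labelling k n P R
  empty ¬P .label p  = ⊥-elim (¬P p)
  empty ¬P .root p   = ⊥-elim (¬P p)
  empty ¬P .edge p   = ⊥-elim (¬P p)
  empty ¬P .walk p   = ⊥-elim (¬P p)

  singleton : ∀ {k n} w → Labelling k (suc n) (_≡ w) (_≡ w)
  singleton w .label _ = here
  singleton w .root refl = w , refl , nil , λ _ _ → z≤n
  singleton w .edge refl refl e = ⊥-elim (Adj-irrefl G e)
  singleton w .walk refl refl p = 0 , z≤n , nil

  beforeᴸ : ∀ {k n P R} → Labelling k (suc n) P R → Labelling (suc k) (suc n) P R
  beforeᴸ L .label p  = left (L .label p)
  beforeᴸ L .root     = L .root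
  beforeᴸ L .edge     = L .edge
  beforeᴸ L .walk p q = L .walk p q ∘ path-left

  afterᴸ : ∀ {k n P R} → Labelling k (suc n) P R → Labelling (suc k) (suc n) P R
  afterᴸ L .label p  = right (L .label p)
  afterᴸ L .root     = L .root
  afterᴸ L .edge     = L .edge
  afterᴸ L .walk p q = L .walk p q ∘ path-right

  module _ {k n : ℕ} {P R : Fin N → Set} (w : Fin N) (adj-roots : ∀ {r} → R r → Adj G w r)
           (L : Labelling (suc k) n P R) where

    -- The root `r` of the tree of `u` becomes a child of `w`, so passing from the distance to `r`
    -- to the distance to `w` takes one `Step`: three choices for each tree edge.
    descend : ∀ {u} (p : P u) → ∃ λ s → IsDist G u w (just (move s (top (L .label p))))
    descend p = dist-step G (proj₂ (proj₂ (L .root p))) (adj-roots (proj₁ (proj₂ (L .root p))))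

    tree : Labelling (suc k) (suc n) (λ u → u ≡ w ⊎ P u) (_≡ w)
    tree .label (inj₁ _) = here
    tree .label (inj₂ p) = below (proj₁ (descend p)) (L .label p)
    tree .root (inj₁ refl) = w , refl , nil , λ _ _ → z≤n
    tree .root (inj₂ p)    = w , refl , proj₂ (descend p)
    tree .edge (inj₁ refl) (inj₁ refl) e = ⊥-elim (Adj-irrefl G e)
    tree .edge (inj₁ refl) (inj₂ q) e = close⁺ z≤n (proj₂ (proj₂ (descend q)) 1 (cons (Adj-sym G e) nil))
    tree .edge (inj₂ p) (inj₁ refl) e = close⁺ (proj₂ (proj₂ (descend p)) 1 (cons e nil)) z≤n
    tree .edge (inj₂ p) (inj₂ q) e = Equivalence.from T-∧
      ( close⁺ (dist-Lipschitz G e (proj₂ (descend p)) (proj₂ (descend q)))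
               (dist-Lipschitz G (Adj-sym G e) (proj₂ (descend q)) (proj₂ (descend p)))
      , L .edge p q e)
    tree .walk (inj₁ refl) (inj₁ refl) _ = 0 , z≤n , nil
    tree .walk (inj₁ refl) (inj₂ q) π = _ , path-from-here π , reverseʷ G (proj₁ (proj₂ (descend q)))
    tree .walk (inj₂ p) (inj₁ refl) π = _ , path-to-here π , proj₁ (proj₂ (descend p))
    tree .walk (inj₂ p) (inj₂ q) π with path-below π
    ... | inj₁ π′ = L .walk p q π′
    -- The path passed through `here`, so it is at least as long as the walk in `G` that joins
    -- shortest walks from `u` to `w` and from `w` to `v`.
    ... | inj₂ le = _ , le , _++ʷ_ G (proj₁ (proj₂ (descend p))) (reverseʷ G (proj₁ (proj₂ (descend q))))

  Separated : (P Q : Fin N → Set) → Set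
  Separated P Q = ∀ {u v} → P u → Q v → ¬ Adj G u v

  -- No edge of `G` joins two pieces and, `part` being constant on paths, no path of labels does
  -- either, so `edge` and `walk` reduce to a single piece.
  union : ∀ {k n} {P : Part → Fin N → Set} {R : Fin N → Set} → (L : ∀ s → Labelling k n (P s) R) →
          (∀ s {u} (p : P s u) → part (L s .label p) ≡ s) →
          (∀ {s t} → s ≢ t → Separated (P s) (P t)) →
          Labelling k n (λ u → ∃ λ s → P s u) R
  union L in-part sep .label (s , p) = L s .label p
  union L in-part sep .root (s , p) = L s .root p
  union L in-part sep .edge (s , p) (t , q) e with s ≟ᵖ t
  ... | yes refl = L s .edge p q e
  ... | no s≢t   = ⊥-elim (sep s≢t p q e)
  union L in-part sep .walk (s , p) (t , q) π
    with ≡-trans (≡-sym (in-part s p)) (≡-trans (path-part π) (in-part t q))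
  ... | refl = L s .walk p q π

-- Depth-first search forests

-- In node v f g, the forest f lies below the root v, and g consists of the remaining trees.
data Forest (N : ℕ) : Set where
  leaf : Forest N
  node : Fin N → Forest N → Forest N → Forest N

size : ∀ {N} → Forest N → ℕ
size leaf         = 0
size (node v f g) = suc (size f + size g)

_∈ᶠ_ : ∀ {N} → Fin N → Forest N → Set
u ∈ᶠ leaf       = ⊥
u ∈ᶠ node v f g = u ≡ v ⊎ u ∈ᶠ f ⊎ u ∈ᶠ g

IsRoot : ∀ {N} → Forest N → Fin N → Set
IsRoot leaf         r = ⊥
IsRoot (node v f g) r = r ≡ v ⊎ IsRoot g r

module _ {N : ℕ} (G : Graph N) where

  Apart : (f g : Forest N) → Set
  Apart f g = Separated G (_∈ᶠ f) (_∈ᶠ g)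

  Apart-sym : ∀ {f g} → Apart f g → Apart g f
  Apart-sym sep p q e = sep q p (Adj-sym G e)

  -- `node v f leaf` is the first tree alone. Separating it from the remaining trees at every level
  -- leaves only edges between ancestors and descendants.
  data Normal : Forest N → Set where
    leaf : Normal leaf
    node : ∀ {v f g} → (∀ {r} → IsRoot f r → Adj G v r) → Normal f → Normal g →
           Apart (node v f leaf) g → Normal (node v f g)

  -- The outcome of a depth-first search that tries `starts` in turn and enters only vertices of
  -- `available`; `rest` is what stays unvisited. `closed` is the invariant that rules out edges to
  -- trees found later.
  record Search (available starts : List (Fin N)) : Set where
    field
      forest  : Forest N
      rest    : List (Fin N)
      normal  : Normal forest
      size≤   : size forest + length rest ≤ length available
      roots   : ∀ {r} → IsRoot forest r → r ∈ starts
      cover   : ∀ {u} → u ∈ available → u ∈ᶠ forest ⊎ u ∈ rest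
      forest⊆ : ∀ {u} → u ∈ᶠ forest → u ∈ available
      rest⊆   : ∀ {u} → u ∈ rest → u ∈ available
      visited : ∀ {u} → u ∈ starts → u ∉ rest
      closed  : Separated G (_∈ᶠ forest) (_∈ rest)

  open Search

  _∈?_ : (u : Fin N) (us : List (Fin N)) → Dec (u ∈ us)
  u ∈? us = Any.any? (u ≟ᶠ_) us

  neighbours : Fin N → List (Fin N)
  neighbours v = filter (λ u → T? (adj G v u)) (allFin N)

  neighbours⁺ : ∀ {u v} → Adj G v u → u ∈ neighbours v
  neighbours⁺ {u} = ∈-filter⁺ _ (∈-allFin u)

  neighbours⁻ : ∀ {u v} → u ∈ neighbours v → Adj G v u
  neighbours⁻ {u} {v} p = proj₂ (∈-filter⁻ (λ u → T? (adj G v u)) {xs = allFin N} p)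

  remove : Fin N → List (Fin N) → List (Fin N)
  remove v = filter (λ u → ¬? (u ≟ᶠ v))

  length-remove : ∀ {v us} → v ∈ us → length (remove v us) < length us
  length-remove {v} {us} p = filter-notAll (λ u → ¬? (u ≟ᶠ v)) us (Any.map (λ { refl ¬p → ¬p refl }) p)

  remove⊆ : ∀ {v us u} → u ∈ remove v us → u ∈ us
  remove⊆ {v} p = proj₁ (∈-filter⁻ (λ u → ¬? (u ≟ᶠ v)) p)

  -- `S` explores from the neighbours of `v`, and `S′` takes the other starts on what `S` left. By
  -- `visited S` no neighbour of `v` is left, and by `closed S` none of a descendant, so the tree of
  -- `v` is apart from all that follows.
  visit : ∀ {us v vs} → v ∈ us → (S : Search (remove v us) (neighbours v)) → Search (rest S) vs →
          Search us (v ∷ vs)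
  visit {us} {v} {vs} v∈us S S′ = record
    { forest  = node v (forest S) (forest S′)
    ; rest    = rest S′
    ; normal  = node (neighbours⁻ ∘ roots S) (normal S) (normal S′) sep
    ; size≤   = bound
    ; roots   = λ { (inj₁ refl) → Any.here refl ; (inj₂ p) → Any.there (roots S′ p) }
    ; cover   = cover′
    ; forest⊆ = λ { (inj₁ refl) → v∈us
                  ; (inj₂ (inj₁ p)) → remove⊆ (forest⊆ S p)
                  ; (inj₂ (inj₂ p)) → remove⊆ (rest⊆ S (forest⊆ S′ p)) }
    ; rest⊆   = λ p → remove⊆ (rest⊆ S (rest⊆ S′ p))
    ; visited = visited′
    ; closed  = λ { (inj₁ refl) q e → visited S (neighbours⁺ e) (rest⊆ S′ q)
                  ; (inj₂ (inj₁ p)) q → closed S p (rest⊆ S′ q)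
                  ; (inj₂ (inj₂ p)) → closed S′ p }
    }
    where
    sep : Apart (node v (forest S) leaf) (forest S′)
    sep (inj₁ refl)     q e = visited S (neighbours⁺ e) (forest⊆ S′ q)
    sep (inj₂ (inj₁ p)) q   = closed S p (forest⊆ S′ q)

    bound : suc (size (forest S) + size (forest S′)) + length (rest S′) ≤ length us
    bound = begin
      suc (size (forest S) + size (forest S′)) + length (rest S′)
        ≡⟨ cong suc (+-assoc (size (forest S)) _ _) ⟩
      suc (size (forest S) + (size (forest S′) + length (rest S′)))
        ≤⟨ s≤s (+-monoʳ-≤ (size (forest S)) (size≤ S′)) ⟩
      suc (size (forest S) + length (rest S))
        ≤⟨ s≤s (size≤ S) ⟩
      suc (length (remove v us))
        ≤⟨ length-remove v∈us ⟩
      length us ∎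
      where open ≤-Reasoning

    cover′ : ∀ {u} → u ∈ us → u ∈ᶠ node v (forest S) (forest S′) ⊎ u ∈ rest S′
    cover′ {u} p with u ≟ᶠ v
    ... | yes u≡v = inj₁ (inj₁ u≡v)
    ... | no  u≢v with cover S (∈-filter⁺ (λ u → ¬? (u ≟ᶠ v)) p u≢v)
    ...   | inj₁ q = inj₁ (inj₂ (inj₁ q))
    ...   | inj₂ q with cover S′ q
    ...     | inj₁ q′ = inj₁ (inj₂ (inj₂ q′))
    ...     | inj₂ q′ = inj₂ q′

    visited′ : ∀ {u} → u ∈ v ∷ vs → u ∉ rest S′
    visited′ (Any.there p)   q = visited S′ p q
    visited′ (Any.here refl) q =
      proj₂ (∈-filter⁻ (λ u → ¬? (u ≟ᶠ v)) {xs = us} (rest⊆ S (rest⊆ S′ q))) refl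

  -- The recursion is lexicographic in `b` and `vs`: entering `v` removes it, which lowers the bound
  -- for both recursive calls, and skipping a start shortens `vs`.
  search : ∀ b us vs → length us ≤ b → Search us vs
  search b us [] _ = record
    { forest = leaf ; rest = us ; normal = leaf ; size≤ = ≤-refl ; roots = λ () ; cover = inj₂
    ; forest⊆ = λ () ; rest⊆ = id ; visited = λ () ; closed = λ () }
  search b us (v ∷ vs) le with v ∈? us
  search b us (v ∷ vs) le | no v∉us = record
    { forest = forest S ; rest = rest S ; normal = normal S ; size≤ = size≤ S ; roots = Any.there ∘ roots S
    ; cover = cover S ; forest⊆ = forest⊆ S ; rest⊆ = rest⊆ S
    ; visited = λ { (Any.here refl) q → v∉us (rest⊆ S q) ; (Any.there p) → visited S p }
    ; closed = closed S }
    where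
    S : Search us vs
    S = search b us vs le
  search zero    []  (v ∷ vs) le | yes ()
  search (suc b) us  (v ∷ vs) le | yes v∈us = visit v∈us S (search b (rest S) vs rest≤)
    where
    remove≤ : length (remove v us) ≤ b
    remove≤ = s≤s⁻¹ (≤-trans (length-remove v∈us) le)

    S : Search (remove v us) (neighbours v)
    S = search b (remove v us) (neighbours v) remove≤

    rest≤ : length (rest S) ≤ b
    rest≤ = ≤-trans (≤-trans (m≤n+m _ (size (forest S))) (size≤ S)) remove≤

  spanning-forest : ∃ λ f → Normal f × size f ≤ N × (∀ u → u ∈ᶠ f)
  spanning-forest = forest S , normal S , size≤N , spans
    where
    S : Search (allFin N) (allFin N)
    S = search (length (allFin N)) (allFin N) (allFin N) ≤-refl

    size≤N : size (forest S) ≤ N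
    size≤N = subst (size (forest S) ≤_) (length-tabulate id) (≤-trans (m≤m+n _ _) (size≤ S))

    spans : ∀ u → u ∈ᶠ forest S
    spans u with cover S (∈-allFin u)
    ... | inj₁ p = p
    -- Every vertex was a start, so none is left in `rest`.
    ... | inj₂ p = ⊥-elim (visited S (∈-allFin u) p)

  -- Splitting a forest at its middle tree

  data AtMostOneTree : Forest N → Set where
    none : AtMostOneTree leaf
    one  : ∀ {v f} → AtMostOneTree (node v f leaf)

  record Split (c h : ℕ) (f : Forest N) : Set where
    field
      piece    : Part → Forest N
      lone     : AtMostOneTree (piece amid)
      before≤  : size (piece before) ≤ c
      after≤   : size (piece after) ≤ h
      size≤    : ∀ s → size (piece s) ≤ size f
      normal   : ∀ s → Normal (piece s)
      within   : ∀ s {u} → u ∈ᶠ piece s → u ∈ᶠ f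
      roots    : ∀ s {r} → IsRoot (piece s) r → IsRoot f r
      cover    : ∀ {u} → u ∈ᶠ f → ∃ λ s → u ∈ᶠ piece s
      apart    : ∀ {s t} → s ≢ t → Apart (piece s) (piece t)

  -- Trees go to `before` while they fit into the budget `c`. The first that does not fit is the
  -- `amid` piece, however large, and the trees behind it form `after`; `amid` is empty if all trees
  -- fit.
  split : ∀ c h f → Normal f → size f ≤ c + h → Split c h f
  split c h leaf _ _ = record
    { piece = λ _ → leaf ; lone = none ; before≤ = z≤n ; after≤ = z≤n ; size≤ = λ _ → z≤n
    ; normal = λ _ → leaf ; within = λ _ () ; roots = λ _ () ; cover = λ () ; apart = λ _ () }
  split c h (node v f g) (node adj-roots nf ng sep) le with suc (size f) ≤? c
  ... | no f≮c = record
    { piece = piece ; lone = one ; before≤ = z≤n ; after≤ = g≤h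
    ; size≤ = λ { before → z≤n
                ; amid → s≤s (+-monoʳ-≤ (size f) z≤n)
                ; after → m≤n⇒m≤1+n (m≤n+m _ _) }
    ; normal = λ { before → leaf ; amid → node adj-roots nf leaf (λ _ ()) ; after → ng }
    ; within = λ { amid (inj₁ p) → inj₁ p ; amid (inj₂ (inj₁ p)) → inj₂ (inj₁ p) ; after p → inj₂ (inj₂ p) }
    ; roots = λ { amid (inj₁ p) → inj₁ p ; after p → inj₂ p }
    ; cover = λ { (inj₁ p) → amid , inj₁ p
                ; (inj₂ (inj₁ p)) → amid , inj₂ (inj₁ p)
                ; (inj₂ (inj₂ p)) → after , p }
    ; apart = apart
    }
    where
    piece : Part → Forest N
    piece before = leaf
    piece amid   = node v f leaf
    piece after  = g

    g≤h : size g ≤ h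
    -- The tree does not fit, so `f` alone has at least `c` vertices, and at most `h` remain for
    -- `g`.
    g≤h = +-cancelˡ-≤ c _ _ (≤-trans (+-monoˡ-≤ (size g) (≮⇒≥ f≮c)) (≤-trans (n≤1+n _) le))

    apart : ∀ {s t} → s ≢ t → Apart (piece s) (piece t)
    apart {amid}  {amid}  s≢t = ⊥-elim (s≢t refl)
    apart {amid}  {after} _   = sep
    apart {after} {amid}  _   = Apart-sym {node v f leaf} {g} sep
    apart {after} {after} s≢t = ⊥-elim (s≢t refl)
  ... | yes f<c with m≤n⇒∃[o]m+o≡n f<c
  ...   | c′ , refl = record
    { piece = piece ; lone = S.lone ; before≤ = s≤s (+-monoʳ-≤ (size f) S.before≤) ; after≤ = S.after≤
    ; size≤ = λ { before → s≤s (+-monoʳ-≤ (size f) (S.size≤ before))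
                ; amid → enlarge (S.size≤ amid)
                ; after → enlarge (S.size≤ after) }
    ; normal = λ { before → node adj-roots nf (S.normal before) (λ p q → sep p (S.within before q))
                 ; amid → S.normal amid
                 ; after → S.normal after }
    ; within = λ { before (inj₁ p) → inj₁ p
                 ; before (inj₂ (inj₁ p)) → inj₂ (inj₁ p)
                 ; before (inj₂ (inj₂ p)) → inj₂ (inj₂ (S.within before p))
                 ; amid p → inj₂ (inj₂ (S.within amid p))
                 ; after p → inj₂ (inj₂ (S.within after p)) }
    ; roots = λ { before (inj₁ p) → inj₁ p
                ; before (inj₂ p) → inj₂ (S.roots before p)
                ; amid p → inj₂ (S.roots amid p)
                ; after p → inj₂ (S.roots after p) }
    ; cover = covers
    ; apart = apart
    }
    where
    g≤c′+h : size g ≤ c′ + h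
    g≤c′+h = +-cancelˡ-≤ (suc (size f)) _ _ (subst (suc (size f + size g) ≤_) (+-assoc (suc (size f)) c′ h) le)

    module S = Split (split c′ h g ng g≤c′+h)

    piece : Part → Forest N
    piece before = node v f (S.piece before)
    piece amid   = S.piece amid
    piece after  = S.piece after

    enlarge : ∀ {m} → m ≤ size g → m ≤ suc (size f + size g)
    enlarge p = m≤n⇒m≤1+n (≤-trans p (m≤n+m _ _))

    covers : ∀ {u} → u ∈ᶠ node v f g → ∃ λ s → u ∈ᶠ piece s
    covers (inj₁ p)        = before , inj₁ p
    covers (inj₂ (inj₁ p)) = before , inj₂ (inj₁ p)
    covers (inj₂ (inj₂ p)) with S.cover p
    ... | before , q = before , inj₂ (inj₂ q)
    ... | amid   , q = amid , q
    ... | after  , q = after , q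

    apart-before : ∀ {t} → before ≢ t → Apart (node v f (S.piece before)) (S.piece t)
    apart-before _   (inj₁ p)        q = sep (inj₁ p) (S.within _ q)
    apart-before _   (inj₂ (inj₁ p)) q = sep (inj₂ (inj₁ p)) (S.within _ q)
    apart-before s≢t (inj₂ (inj₂ p)) q = S.apart s≢t p q

    apart : ∀ {s t} → s ≢ t → Apart (piece s) (piece t)
    apart {before} {before} s≢t = ⊥-elim (s≢t refl)
    apart {before} {amid}   s≢t = apart-before s≢t
    apart {before} {after}  s≢t = apart-before s≢t
    apart {amid}   {before} s≢t = Apart-sym {piece before} {S.piece amid} (apart-before (s≢t ∘ ≡-sym))
    apart {amid}   {amid}   s≢t = S.apart s≢t
    apart {amid}   {after}  s≢t = S.apart s≢t
    apart {after}  {before} s≢t = Apart-sym {piece before} {S.piece after} (apart-before (s≢t ∘ ≡-sym))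
    apart {after}  {amid}   s≢t = S.apart s≢t
    apart {after}  {after}  s≢t = S.apart s≢t

  -- Labelling a normal forest

  size≡0⇒empty : ∀ (f : Forest N) {u} → size f ≤ 0 → ¬ (u ∈ᶠ f)
  size≡0⇒empty leaf _ ()

  ForestLabelling : ℕ → ℕ → Forest N → Set
  ForestLabelling k n f = Labelling G k n (_∈ᶠ f) (IsRoot f)

  -- The outer pieces have at most half of the allowed `2 ^ suc k` vertices and are labelled with
  -- `k`. The middle tree can be all of `f`, so it keeps `suc k`, but removing its root lowers `n`,
  -- which bounds the depth by way of the size.
  labelling : ∀ k n f → Normal f → size f ≤ 2 ^ k → size f ≤ n → ForestLabelling k n f
  labelling k       zero    f _ _ le = empty G (size≡0⇒empty f le)
  labelling zero    (suc n) leaf nf _ _ = empty G λ ()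
  labelling zero    (suc n) (node v f g) nf (s≤s le) _ =
    restrict G (λ { (inj₁ p) → p
                  ; (inj₂ (inj₁ p)) → ⊥-elim (size≡0⇒empty f (≤-trans (m≤m+n (size f) _) le) p)
                  ; (inj₂ (inj₂ p)) → ⊥-elim (size≡0⇒empty g (≤-trans (m≤n+m _ (size f)) le) p) })
               inj₁ (singleton G v)
  labelling (suc k) (suc n) f nf f≤2^ f≤n =
    restrict G S.cover id (union G (λ s → restrict G id (S.roots s) (proj₁ (L s))) (λ s → proj₂ (L s)) S.apart)
    where
    module S = Split (split (2 ^ k) (2 ^ k) f nf (subst (λ m → size f ≤ 2 ^ k + m) (+-identityʳ (2 ^ k)) f≤2^))

    LabellingIn : Part → Forest N → Set
    LabellingIn s g = Σ (ForestLabelling (suc k) (suc n) g) λ L → ∀ {u} (p : u ∈ᶠ g) → part (Labelling.label L p) ≡ s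

    tree-labelling : ∀ g → AtMostOneTree g → Normal g → size g ≤ size f → LabellingIn amid g
    tree-labelling _ none _ _ = empty G {R = IsRoot leaf} (λ ()) , λ ()
    tree-labelling (node v g leaf) one (node adj-roots ng _ _) le =
      restrict G (λ { (inj₁ p) → inj₁ p ; (inj₂ (inj₁ p)) → inj₂ p }) inj₁
        (tree G v adj-roots (labelling (suc k) n g ng (≤-trans (<⇒≤ g<f) f≤2^) (s≤s⁻¹ (≤-trans g<f f≤n))))
      , λ { (inj₁ p) → refl ; (inj₂ (inj₁ p)) → refl }
      where
      g<f : suc (size g) ≤ size f
      g<f = ≤-trans (s≤s (m≤m+n (size g) _)) le

    L : ∀ s → LabellingIn s (S.piece s)
    L before =
      beforeᴸ G (labelling k (suc n) (S.piece before) (S.normal before) S.before≤ (≤-trans (S.size≤ before) f≤n))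
      , λ _ → refl
    L amid   = tree-labelling (S.piece amid) S.lone (S.normal amid) (S.size≤ amid)
    L after  =
      afterᴸ G (labelling k (suc n) (S.piece after) (S.normal after) S.after≤ (≤-trans (S.size≤ after) f≤n))
      , λ _ → refl

-- Counting labels

labels : ∀ k n → List (Label k n)
labels k       zero    = []
labels zero    (suc n) = here ∷ []
labels (suc k) (suc n) =
  here ∷ map left (labels k (suc n)) ++ map right (labels k (suc n)) ++
  map (below down) (labels (suc k) n) ++ map (below stay) (labels (suc k) n) ++ map (below up) (labels (suc k) n)

∈-labels : ∀ {k n} (x : Label k n) → x ∈ labels k n
∈-labels {zero}  here = Any.here refl
∈-labels {suc k} here = Any.here refl
∈-labels (left x)     = Any.there (∈-++⁺ˡ (∈-map⁺ left (∈-labels x)))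
∈-labels (right {k} {n} x) =
  Any.there (∈-++⁺ʳ (map left (labels k (suc n))) (∈-++⁺ˡ (∈-map⁺ right (∈-labels x))))
∈-labels (below {k} {n} s x) =
  Any.there (∈-++⁺ʳ (map left (labels k (suc n))) (∈-++⁺ʳ (map right (labels k (suc n))) (at s (∈-labels x))))
  where
  M : List (Label (suc k) n)
  M = labels (suc k) n

  at : ∀ s → x ∈ M → below s x ∈ map (below down) M ++ map (below stay) M ++ map (below up) M
  at down p = ∈-++⁺ˡ (∈-map⁺ (below down) p)
  at stay p = ∈-++⁺ʳ (map (below down) M) (∈-++⁺ˡ (∈-map⁺ (below stay) p))
  at up   p = ∈-++⁺ʳ (map (below down) M) (∈-++⁺ʳ (map (below stay) M) (∈-map⁺ (below up) p))

length-map-++ : ∀ {A B : Set} (f : A → B) xs ys → length (map f xs ++ ys) ≡ length xs + length ys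
length-map-++ f xs ys = ≡-trans (length-++ (map f xs)) (cong (_+ length ys) (length-map f xs))

length-labels : ∀ k n → let l = length (labels k (suc n)) ; m = length (labels (suc k) n) in
                length (labels (suc k) (suc n)) ≡ suc (l + (l + (m + (m + m))))
length-labels k n = cong suc (length-branches (labels k (suc n)) (labels (suc k) n))
  where
  length-branches : ∀ L M →
    length (map left L ++ map right L ++ map (below down) M ++ map (below stay) M ++ map (below up) M)
    ≡ length L + (length L + (length M + (length M + length M)))
  length-branches L M
    rewrite length-map-++ left L (map right L ++ map (below down) M ++ map (below stay) M ++ map (below up) M)
          | length-map-++ right L (map (below down) M ++ map (below stay) M ++ map (below up) M)
          | length-map-++ (below down) M (map (below stay) M ++ map (below up) M)
          | length-map-++ (below stay) M (map (below up) M)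
          | length-map (below up) M = refl

-- Relative to `3 ^ n`, the three copies for `below` carry the previous bound over unchanged, while
-- `here` and the two copies for `k` add at most `B` each. Thus every level contributes `3 * B`.
length-labels-suc : ∀ k N B → 1 ≤ B → (∀ n → n ≤ N → length (labels k n) ≤ 3 ^ n * B) →
                    ∀ n → n ≤ N → length (labels (suc k) n) ≤ 3 ^ n * (3 * n * B)
length-labels-suc k N B 1≤B bound zero    _  = z≤n
length-labels-suc k N B 1≤B bound (suc n) le = begin
  length (labels (suc k) (suc n))      ≡⟨ length-labels k n ⟩
  suc (l + (l + (m + (m + m))))        ≤⟨ +-mono-≤ 1≤a (+-mono-≤ l≤ (+-mono-≤ l≤ (+-mono-≤ m≤ (+-mono-≤ m≤ m≤)))) ⟩
  a + (a + (a + (b + (b + b))))        ≡⟨ identity (3 ^ n) n B ⟩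
  3 ^ suc n * (3 * suc n * B)          ∎
  where
  open ≤-Reasoning

  l m a b : ℕ
  l = length (labels k (suc n))
  m = length (labels (suc k) n)
  a = 3 ^ suc n * B
  b = 3 ^ n * (3 * n * B)

  1≤a : 1 ≤ a
  1≤a = *-mono-≤ (m^n>0 3 (suc n)) 1≤B

  l≤ : l ≤ a
  l≤ = bound (suc n) le

  m≤ : m ≤ b
  m≤ = length-labels-suc k N B 1≤B bound n (<⇒≤ le)

  identity : ∀ x n B → 3 * x * B + (3 * x * B + (3 * x * B + (x * (3 * n * B) + (x * (3 * n * B) + x * (3 * n * B)))))
                       ≡ 3 * x * (3 * suc n * B)
  identity = solve-∀

length-labels-≤ : ∀ k N → 1 ≤ N → ∀ n → n ≤ N → length (labels k n) ≤ 3 ^ n * (3 * N) ^ k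
length-labels-≤ zero    N 1≤N zero    _  = z≤n
length-labels-≤ zero    N 1≤N (suc n) le = *-mono-≤ (m^n>0 3 (suc n)) ≤-refl
length-labels-≤ (suc k) N@(suc _) 1≤N n       le = ≤-trans
  (length-labels-suc k N ((3 * N) ^ k) (m^n>0 (3 * N) k) (length-labels-≤ k N 1≤N) n le)
  (*-monoʳ-≤ (3 ^ n) (*-monoˡ-≤ ((3 * N) ^ k) (*-monoʳ-≤ 3 le)))

-- Stated for all accessibility proofs, so that the induction follows the recursion of `⌈log2⌉`,
-- which takes `suc (suc n)` to `suc ⌈ n /2⌉`.
n≤2^⌈log2⌉n : ∀ n rec → n ≤ 2 ^ ⌈log2⌉ n rec
n≤2^⌈log2⌉n 0 _ = z≤n
n≤2^⌈log2⌉n 1 _ = ≤-refl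
n≤2^⌈log2⌉n (suc (suc n)) (acc rs) = begin
  suc (suc n)                       ≡⟨ cong (suc ∘ suc) (⌊n/2⌋+⌈n/2⌉≡n n) ⟨
  suc (suc (⌊ n /2⌋ + ⌈ n /2⌉))     ≤⟨ s≤s (s≤s (+-monoˡ-≤ ⌈ n /2⌉ (⌊n/2⌋≤⌈n/2⌉ n))) ⟩
  suc (suc (⌈ n /2⌉ + ⌈ n /2⌉))     ≡⟨ double ⌈ n /2⌉ ⟩
  2 * suc ⌈ n /2⌉                   ≤⟨ *-monoʳ-≤ 2 (n≤2^⌈log2⌉n (suc ⌈ n /2⌉) _) ⟩
  2 ^ ⌈log2⌉ (suc (suc n)) (acc rs) ∎
  where
  open ≤-Reasoning

  double : ∀ h → suc (suc (h + h)) ≡ 2 * suc h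
  double = solve-∀

n≤2^⌈log₂n⌉ : ∀ n → n ≤ 2 ^ ⌈log₂ n ⌉
n≤2^⌈log₂n⌉ n = n≤2^⌈log2⌉n n (<-wellFounded n)

[1+k]*k≤2*k² : ∀ k → suc k * k ≤ 2 * k ^ 2
[1+k]*k≤2*k² zero      = z≤n
[1+k]*k≤2*k² k@(suc _) = begin
  k + k * k     ≤⟨ +-monoˡ-≤ (k * k) (m≤m*n k k) ⟩
  k * k + k * k ≡⟨ identity k ⟩
  2 * k ^ 2     ∎
  where
  open ≤-Reasoning

  identity : ∀ k → k * k + k * k ≡ 2 * (k * (k * 1))
  identity = solve-∀

length-labels-log : ∀ n → 1 ≤ n → length (labels ⌈log₂ n ⌉ n) ≤ 3 ^ (n + 2 * ⌈log₂ n ⌉ ^ 2)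
length-labels-log n 1≤n = begin
  length (labels k n)       ≤⟨ length-labels-≤ k n 1≤n n ≤-refl ⟩
  -- As `n ≤ 2 ^ k ≤ 3 ^ k`, the base `3 * n` is at most `3 ^ suc k`, which turns the factor into a
  -- power of 3.
  3 ^ n * (3 * n) ^ k       ≤⟨ *-monoʳ-≤ (3 ^ n) (^-monoˡ-≤ k (*-monoʳ-≤ 3 n≤3^k)) ⟩
  3 ^ n * (3 ^ suc k) ^ k   ≡⟨ cong (3 ^ n *_) (^-*-assoc 3 (suc k) k) ⟩
  -- The exponent is `k + k * k` with `k ≤ k * k`; hence the constant 2 in the theorem.
  3 ^ n * 3 ^ (suc k * k)   ≤⟨ *-monoʳ-≤ (3 ^ n) (^-monoʳ-≤ 3 ([1+k]*k≤2*k² k)) ⟩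
  3 ^ n * 3 ^ (2 * k ^ 2)   ≡⟨ ^-distribˡ-+-* 3 n (2 * k ^ 2) ⟨
  3 ^ (n + 2 * k ^ 2)       ∎
  where
  open ≤-Reasoning

  k : ℕ
  k = ⌈log₂ n ⌉

  n≤3^k : n ≤ 3 ^ k
  n≤3^k = ≤-trans (n≤2^⌈log₂n⌉ n) (^-monoˡ-≤ k (n≤1+n 2))

-- Universality

universal : ∀ k n → Graph (length (labels k n))
universal k n .adj i j  = adjᴸ (lookup (labels k n) i) (lookup (labels k n) j)
universal k n .Graph.sym i j = adjᴸ-sym (lookup (labels k n) i) (lookup (labels k n) j)
universal k n .irrefl i = adjᴸ-irrefl (lookup (labels k n) i)

walk⇒path : ∀ {k n j x y} → Walk (universal k n) j x y → Path j (lookup (labels k n) x) (lookup (labels k n) y)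
walk⇒path nil        = nil
walk⇒path (cons e w) = cons e (walk⇒path w)

map-walk : ∀ {n m} {G : Graph n} {H : Graph m} {f : Fin n → Fin m} → (∀ u v → Adj G u v → Adj H (f u) (f v)) →
           ∀ {j u v} → Walk G j u v → Walk H j (f u) (f v)
map-walk edge nil        = nil
map-walk edge (cons e w) = cons (edge _ _ e) (map-walk edge w)

-- Shortening a walk of length 0 gives injectivity. Mapping walks forward and shortening them
-- backward makes the least lengths agree, and shows that walks exist in both graphs or in neither.
isometric : ∀ {n m} {G : Graph n} {H : Graph m} {f : Fin n → Fin m} →
            (∀ u v → Adj G u v → Adj H (f u) (f v)) →
            (∀ {j} u v → Walk H j (f u) (f v) → ∃ λ i → i ≤ j × Walk G i u v) →
            IsometricEmbedding G H f
isometric {G = G} {H} {f} edge shorten = injective , edge , λ u v d → mk⇔ (to u v d) (from u v d)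
  where
  injective : ∀ {u v} → f u ≡ f v → u ≡ v
  injective {u} {v} eq with shorten u v (subst (Walk H 0 (f u)) eq nil)
  ... | zero , _ , nil = refl

  to : ∀ u v d → IsDist G u v d → IsDist H (f u) (f v) d
  to u v nothing  ¬w j w = let i , _ , w′ = shorten u v w in ¬w i w′
  to u v (just k) (w , least) = map-walk edge w , λ j w′ →
    let i , i≤j , w″ = shorten u v w′ in ≤-trans (least i w″) i≤j

  from : ∀ u v d → IsDist H (f u) (f v) d → IsDist G u v d
  from u v nothing  ¬w j w = ¬w j (map-walk edge w)
  from u v (just k) (w , least) with shorten u v w
  -- The image of the shortened walk lies in `H`, where `k` is least, so `i` equals `k`.
  ... | i , i≤k , w′ with ≤-antisym i≤k (least i (map-walk edge w′))
  ...   | refl = w′ , λ j w″ → least j (map-walk edge w″)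

labelling⇒copy : ∀ {N k n R} (G : Graph N) {P : Fin N → Set} → Labelling G k n P R → (∀ u → P u) →
                 HasIsometricCopy (universal k n) G
labelling⇒copy {N} {k} {n} G L total = f , isometric
  (λ u v e → subst₂ Adjᴸ (lookup-f u) (lookup-f v) (Labelling.edge L (total u) (total v) e))
  (λ u v w → Labelling.walk L (total u) (total v)
               (subst₂ (Path _) (≡-sym (lookup-f u)) (≡-sym (lookup-f v)) (walk⇒path w)))
  where
  f : Fin N → Fin (length (labels k n))
  f u = index (∈-labels (Labelling.label L (total u)))

  lookup-f : ∀ u → Labelling.label L (total u) ≡ lookup (labels k n) (f u)
  lookup-f u = lookup-index (∈-labels (Labelling.label L (total u)))

universal-isometric : ∀ n → IsometricUniversal n (universal ⌈log₂ n ⌉ n)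
universal-isometric n G =
  let f , nf , f≤n , spans = spanning-forest G
  in labelling⇒copy G (labelling G ⌈log₂ n ⌉ n f nf (≤-trans f≤n (n≤2^⌈log₂n⌉ n)) f≤n) spans

theorem1p2 : Σ ℕ λ C → 0 < C × ((n : ℕ) → 1 ≤ n →
    Σ ℕ λ m → Σ (Graph m) λ H →
    m ≤ 3 ^ (n + C * (⌈log₂ n ⌉ ^ 2)) × IsometricUniversal n H)
theorem1p2 = 2 , s≤s z≤n , λ n 1≤n →
  _ , universal ⌈log₂ n ⌉ n , length-labels-log n 1≤n , universal-isometric n
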